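{- Let $f$ and $F$ be primitive integral binary quadratic forms with non-square discriminants $d$ and $D$, respectively, and suppose $f(\mathbb{Z}^2)=F(\mathbb{Z}^2)$. Then $d$ and $D$ have the same sign, and $d=D$, $d=4D$, or $4d=D$. Furthermore, if $0<|d|<|D|$, then $d\equiv 5\pmod 8$.
   Context: A form $aX^2+bXY+cY^2$ with $a,b,c\in\mathbb{Z}$ is primitive if $\gcd(a,b,c)=1$; its discriminant is $b^2-4ac$. -}

module Defs where

open import Data.Integer using (ℤ; +_; _+_; _-_; _*_; ∣_∣; _<_)
open import Data.Integer.GCD using (gcd)
open import Data.Integer.Divisibility using (_∣_)
open import Data.Product using (Σ; ∃; _×_; _,_)
open import Relation.Binary.PropositionalEquality using (_≡_)
open import Relation.Nullary using (¬_)
open import Function.Bundles using (_⇔_)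

-- An integral binary quadratic form a X² + b X Y + c Y².
record BQF : Set where
  constructor form
  field
    a b c : ℤ
open BQF public

eval : BQF → ℤ → ℤ → ℤ
eval f x y = a f * x * x + b f * x * y + c f * y * y

disc : BQF → ℤ
disc f = b f * b f - + 4 * a f * c f

Primitive : BQF → Set
Primitive f = gcd (gcd (a f) (b f)) (c f) ≡ + 1

IsSquare : ℤ → Set
IsSquare n = ∃ λ k → k * k ≡ n

Represents : BQF → ℤ → Set
Represents f n = Σ ℤ λ x → Σ ℤ λ y → eval f x y ≡ n

SameImage : BQF → BQF → Set
SameImage f F = (n : ℤ) → Represents f n ⇔ Represents F n

open import Data.Sum using (_⊎_)
SameSign : ℤ → ℤ → Set
SameSign d D = ((+ 0 < d) × (+ 0 < D)) ⊎ ((d < + 0) × (D < + 0))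

{-# OPTIONS --safe #-}
module Submission where

open import Defs
open import Data.Integer using (ℤ; +_; _*_; _-_; ∣_∣)
open import Data.Integer.Divisibility using (_∣_)
open import Data.Nat using (_<_)
open import Data.Product using (_×_)
open import Data.Sum using (_⊎_)
open import Relation.Binary.PropositionalEquality using (_≡_)
open import Relation.Nullary using (¬_)

open import Data.Empty using (⊥; ⊥-elim)
open import Data.Fin as Fin using (Fin; toℕ; fromℕ<)
import Data.Fin.Properties as Fin
open import Data.Integer using (-[1+_]; _+_; -_; ≢-nonZero; _%ℕ_; _/ℕ_; +<+; -<+)
import Data.Integer as ℤ
import Data.Integer.DivMod as ℤ
import Data.Integer.Divisibility.Signed as Signed
open Signed using (divides; ∣ᵤ⇒∣; ∣⇒∣ᵤ)
import Data.Integer.GCD as ℤ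
import Data.Integer.Properties as ℤ
open import Data.Integer.Tactic.RingSolver using (solve)
open import Data.List using (_∷_; [])
open import Data.Nat as ℕ using (ℕ; zero; suc)
import Data.Nat.Divisibility as ℕ
import Data.Nat.GCD as ℕ
open import Data.Nat.Induction using (<-wellFounded; Acc; acc)
import Data.Nat.Properties as ℕ
open import Data.Product using (∃; ∃₂; _,_; proj₁; proj₂)
open import Data.Sum using (inj₁; inj₂)
open import Function using (_∘_; case_of_; case_returning_of_)
open import Function.Bundles using (Equivalence)
open import Relation.Binary.PropositionalEquality using (_≢_; refl; sym; trans; cong; cong₂; subst)
open import Relation.Nullary using (yes; no)

-- Since F(U) can be made coprime to any m, and products F(U) F(V) are the values of the
-- principal form of discriminant D, equality of the images makes the principal forms
-- x² + e x y + k y² (e = 0 or 1, discriminant e - 4k) of discriminants d and D represent the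
-- same residues modulo every m.  Modulo a divisor m of the discriminant, the principal form
-- takes only squares (for m odd, or m | k when e = 0).  If z² + K y² is always a square mod m,
-- then adding K preserves squares, so all multiples of g = gcd(K, m) are squares mod m, hence
-- everything is a square mod h = m / g; as squaring identifies 1 and -1, h divides 2.  This
-- gives mutual divisibility of d and D up to powers of 2, which congruences mod 8 and mod 4
-- settle; the signs agree because F takes the values A and -AD.

-- An equation modulo hypotheses becomes a ring identity once the cofactors c are supplied.

lin₁ : ∀ {L R p q : ℤ} c → p ≡ q → L - R ≡ c * (p - q) → L ≡ R
lin₁ {L} {R} {p} c refl e =
  ℤ.i-j≡0⇒i≡j L R (trans e (trans (cong (c *_) (ℤ.+-inverseʳ p)) (ℤ.*-zeroʳ c)))

lin₂ : ∀ {L R p q p′ q′ : ℤ} c c′ → p ≡ q → p′ ≡ q′ →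
       L - R ≡ c * (p - q) + c′ * (p′ - q′) → L ≡ R
lin₂ {p = p} {p′ = p′} c c′ refl refl e = lin₁ c (refl {x = p}) (trans e (trans
  (cong (λ z → c * (p - p) + z) (trans (cong (c′ *_) (ℤ.+-inverseʳ p′)) (ℤ.*-zeroʳ c′)))
  (ℤ.+-identityʳ _)))

lin₃ : ∀ {L R p q p′ q′ p″ q″ : ℤ} c c′ c″ → p ≡ q → p′ ≡ q′ → p″ ≡ q″ →
       L - R ≡ c * (p - q) + c′ * (p′ - q′) + c″ * (p″ - q″) → L ≡ R
lin₃ {p = p} {p′ = p′} {p″ = p″} c c′ c″ refl refl refl e =
  lin₂ c c′ (refl {x = p}) (refl {x = p′}) (trans e (trans
    (cong (λ z → c * (p - p) + c′ * (p′ - p′) + z)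
          (trans (cong (c″ *_) (ℤ.+-inverseʳ p″)) (ℤ.*-zeroʳ c″)))
    (ℤ.+-identityʳ _)))

cancel : ∀ {i j k : ℤ} → i ≢ + 0 → i * j ≡ i * k → j ≡ k
cancel {i} {j} {k} i≢0 = ℤ.*-cancelˡ-≡ i j k {{≢-nonZero i≢0}}

cancel-2 : ∀ {j k : ℤ} → + 2 * j ≡ + 2 * k → j ≡ k
cancel-2 = cancel {+ 2} λ ()

*-≢0 : ∀ {i j : ℤ} → i ≢ + 0 → j ≢ + 0 → i * j ≢ + 0
*-≢0 {i} i≢0 j≢0 ij≡0 with ℤ.i*j≡0⇒i≡0∨j≡0 i ij≡0
... | inj₁ i≡0 = i≢0 i≡0
... | inj₂ j≡0 = j≢0 j≡0

∣∣-signed : ∀ i → ∃ λ σ → + ∣ i ∣ ≡ σ * i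
∣∣-signed (+ n)    = + 1 , sym (ℤ.*-identityˡ (+ n))
∣∣-signed -[1+ n ] = ℤ.-1ℤ , sym (ℤ.-1*i≡-i -[1+ n ])

signed-∣∣ : ∀ i → ∃ λ σ → i ≡ σ * + ∣ i ∣
signed-∣∣ (+ n)    = + 1 , sym (ℤ.*-identityˡ (+ n))
signed-∣∣ -[1+ n ] = ℤ.-1ℤ , sym (ℤ.-1*i≡-i (+ suc n))

∣i∣≡1⇒i²≡1 : ∀ i → ∣ i ∣ ≡ 1 → i * i ≡ + 1
∣i∣≡1⇒i²≡1 (+ .1)       refl = refl
∣i∣≡1⇒i²≡1 -[1+ zero ]  _    = refl

-- Parity

1-not-even : ∀ n → + 1 ≢ + 2 * n
1-not-even n eq with ℕ.∣1⇒≡1 (ℕ.divides ∣ n ∣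
  (trans (cong ∣_∣ eq) (trans (ℤ.abs-* (+ 2) n) (ℕ.*-comm 2 ∣ n ∣))))
... | ()

r+h2≡2h+r : ∀ r h → r + h * + 2 ≡ + 2 * h + r
r+h2≡2h+r r h = solve (r ∷ h ∷ [])

parity : ∀ n → ∃ λ h → n ≡ + 2 * h + + 0 ⊎ n ≡ + 2 * h + + 1
parity n with n %ℕ 2 | n /ℕ 2 | ℤ.a≡a%ℕn+[a/ℕn]*n n 2 | ℤ.n%ℕd<d n 2
... | 0 | h | eq | _ = h , inj₁ (trans eq (r+h2≡2h+r (+ 0) h))
... | 1 | h | eq | _ = h , inj₂ (trans eq (r+h2≡2h+r (+ 1) h))
... | suc (suc _) | _ | _ | ℕ.s≤s (ℕ.s≤s ())

i²+i-even : ∀ i → ∃ λ j → i * i + i ≡ + 2 * j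
i²+i-even i = case parity i returning (λ _ → ∃ λ j → i * i + i ≡ + 2 * j) of λ where
  (h , inj₁ refl) → h * (+ 2 * h + + 1) , solve (h ∷ [])
  (h , inj₂ refl) → (+ 2 * h + + 1) * (h + + 1) , solve (h ∷ [])

-- Squares are 0 or 1 modulo 4, so their differences are 0, 1 or 3; each pair of parities makes 1
-- even.
i²-j²≢2mod4 : ∀ i j u → i * i - j * j ≢ + 2 + + 4 * u
i²-j²≢2mod4 i j u eq = case (parity i , parity j) of λ where
  ((x , inj₁ refl) , (y , inj₁ refl)) →
    1-not-even (x * x - y * y - u) (cancel-2 (lin₁ (- + 1) eq (solve (x ∷ y ∷ u ∷ []))))
  ((x , inj₁ refl) , (y , inj₂ refl)) →
    1-not-even (+ 2 * x * x - + 2 * y * y - + 2 * y - + 1 - + 2 * u)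
      (lin₁ (- + 1) eq (solve (x ∷ y ∷ u ∷ [])))
  ((x , inj₂ refl) , (y , inj₁ refl)) →
    1-not-even (+ 2 * y * y - + 2 * x * x - + 2 * x + + 1 + + 2 * u)
      (lin₁ (+ 1) eq (solve (x ∷ y ∷ u ∷ [])))
  ((x , inj₂ refl) , (y , inj₂ refl)) →
    1-not-even (x * x + x - y * y - y - u)
      (cancel-2 (lin₁ (- + 1) eq (solve (x ∷ y ∷ u ∷ []))))

-- With the odd number v = 2p + 1, the right side is 5 - 2vδ² modulo 8. It is 5 for δ even and 3 or
-- 7 for δ odd, whereas an odd square is 1.
no-solution-mod-8 : ∀ r δ t p q →
  r * r ≢ (+ 2 * p + + 1 + + 4 * (+ 2 * q + + 1) - + 2 * δ * δ - + 16 * t) * (+ 2 * p + + 1)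
no-solution-mod-8 r δ t p q eq =
  case (parity r , parity δ , i²+i-even p) of λ where
    ((i , inj₁ refl) , _ , _) →
      1-not-even (+ 2 * i * i - + 2 * (+ 2 * q + + 1) * (+ 2 * p + + 1)
                  + (+ 2 * p + + 1) * δ * δ + + 8 * t * (+ 2 * p + + 1)
                  - + 2 * p * p - + 2 * p)
        (lin₁ (- + 1) eq (solve (i ∷ δ ∷ t ∷ p ∷ q ∷ [])))
    ((i , inj₂ refl) , (j , inj₁ refl) , (P , eqP)) → case i²+i-even i of λ where
      (I , eqI) →
        1-not-even (I - P + (+ 2 * p + + 1) * j * j + + 2 * t * (+ 2 * p + + 1)
                    - + 2 * q * p - q - p)
          (cancel {+ 4} (λ ()) (lin₃ (- + 1) (+ 4) (- + 4) eq eqI eqP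
            (solve (i ∷ j ∷ t ∷ p ∷ q ∷ I ∷ P ∷ []))))
    ((i , inj₂ refl) , (j , inj₂ refl) , _) →
      1-not-even (p * p - i * i - i + (+ 2 * q + + 1) * (+ 2 * p + + 1)
                  - + 2 * (+ 2 * p + + 1) * (j * j + j) - + 4 * t * (+ 2 * p + + 1))
        (cancel-2 (lin₁ (+ 1) eq (solve (i ∷ j ∷ t ∷ p ∷ q ∷ []))))

-- Greatest common divisors

bezout : ∀ i j → ∃₂ λ s t → s * i + t * j ≡ ℤ.gcd i j
bezout i j with ∣∣-signed i | ∣∣-signed j | ℕ.Bézout.identity (ℕ.gcd-GCD ∣ i ∣ ∣ j ∣)
... | σ , eqσ | τ , eqτ | ℕ.Bézout.Identity.+- x y eq = + x * σ , - (+ y * τ) ,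
  combine (+ ℕ.gcd ∣ i ∣ ∣ j ∣) (+ x) (+ y) (+ ∣ i ∣) (+ ∣ j ∣)
    (trans (cong (λ n → + ℕ.gcd ∣ i ∣ ∣ j ∣ + n) (sym (ℤ.pos-* y ∣ j ∣)))
      (trans (cong +_ eq) (ℤ.pos-* x ∣ i ∣))) eqσ eqτ
  where
  combine : ∀ g X Y I J → g + Y * J ≡ X * I → I ≡ σ * i → J ≡ τ * j →
            X * σ * i + - (Y * τ) * j ≡ g
  combine g X Y I J e e′ e″ = lin₃ (- + 1) (- X) Y e e′ e″
    (solve (g ∷ X ∷ Y ∷ I ∷ J ∷ σ ∷ τ ∷ i ∷ j ∷ []))
... | σ , eqσ | τ , eqτ | ℕ.Bézout.Identity.-+ x y eq = - (+ x * σ) , + y * τ ,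
  combine (+ ℕ.gcd ∣ i ∣ ∣ j ∣) (+ x) (+ y) (+ ∣ i ∣) (+ ∣ j ∣)
    (trans (cong (λ n → + ℕ.gcd ∣ i ∣ ∣ j ∣ + n) (sym (ℤ.pos-* x ∣ i ∣)))
      (trans (cong +_ eq) (ℤ.pos-* y ∣ j ∣))) eqσ eqτ
  where
  combine : ∀ g X Y I J → g + X * I ≡ Y * J → I ≡ σ * i → J ≡ τ * j →
            - (X * σ) * i + Y * τ * j ≡ g
  combine g X Y I J e e′ e″ = lin₃ (- + 1) X (- Y) e e′ e″
    (solve (g ∷ X ∷ Y ∷ I ∷ J ∷ σ ∷ τ ∷ i ∷ j ∷ []))

-- Being a common divisor and a linear combination makes `g` a gcd up to sign.
record GCDSplit (i j : ℤ) : Set where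
  constructor gcdSplit
  field
    g i′ j′ s t : ℤ
    i≡gi′ : i ≡ g * i′
    j≡gj′ : j ≡ g * j′
    si+tj≡g : s * i + t * j ≡ g

split-gcd : ∀ i j → GCDSplit i j
split-gcd i j with bezout i j | ∣ᵤ⇒∣ {ℤ.gcd i j} {i} (ℤ.gcd[i,j]∣i i j)
     | ∣ᵤ⇒∣ {ℤ.gcd i j} {j} (ℤ.gcd[i,j]∣j i j)
... | s , t , eq | divides i′ eqi | divides j′ eqj =
  gcdSplit (ℤ.gcd i j) i′ j′ s t
    (trans eqi (ℤ.*-comm i′ (ℤ.gcd i j))) (trans eqj (ℤ.*-comm j′ (ℤ.gcd i j))) eq

-- After division by the gcd t of X and g, the coprime X′ and g′ satisfy X′² = g′² E, so g′ is a
-- unit and g divides X.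
square-cofactor : ∀ {X g E} → g ≢ + 0 → X * X ≡ g * g * E →
                  ∃ λ w → X ≡ g * w × w * w ≡ E
square-cofactor {X} {g} {E} = go (split-gcd X g)
  where
  go : ∀ {X g} → GCDSplit X g → g ≢ + 0 → X * X ≡ g * g * E →
       ∃ λ w → X ≡ g * w × w * w ≡ E
  go (gcdSplit t X′ g′ s r refl refl bz) g≢0 eq = q * X′ , X≡gw , w²≡E
   where
    t≢0 : t ≢ + 0
    t≢0 refl = g≢0 refl
    coprime : s * X′ + r * g′ ≡ + 1
    coprime = cancel t≢0 (lin₁ (+ 1) bz (solve (t ∷ X′ ∷ g′ ∷ s ∷ r ∷ [])))
    eq′ : X′ * X′ ≡ g′ * g′ * E
    eq′ = cancel (*-≢0 t≢0 t≢0) (lin₁ (+ 1) eq (solve (t ∷ X′ ∷ g′ ∷ E ∷ [])))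
    -- Squaring s X′ + r g′ = 1 and replacing X′² by g′² E leaves g′ q = 1.
    q : ℤ
    q = s * s * g′ * E + + 2 * s * r * X′ + r * r * g′
    g′-unit : g′ * (s * s * g′ * E + + 2 * s * r * X′ + r * r * g′) ≡ + 1
    g′-unit = lin₂ (s * X′ + r * g′ + + 1) (- (s * s)) coprime eq′
      (solve (s ∷ r ∷ X′ ∷ g′ ∷ E ∷ []))
    unit-scale : ∀ q → g′ * q ≡ + 1 → t * X′ ≡ t * g′ * (q * X′)
    unit-scale q e = lin₁ (- (t * X′)) e (solve (t ∷ X′ ∷ g′ ∷ q ∷ []))
    X≡gw : t * X′ ≡ t * g′ * (q * X′)
    X≡gw = unit-scale q g′-unit
    w²≡E : (q * X′) * (q * X′) ≡ E
    w²≡E = cancel (*-≢0 g≢0 g≢0)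
      (trans (regroup (t * g′) (q * X′)) (trans (sym (cong₂ _*_ X≡gw X≡gw)) eq))
      where
      regroup : ∀ a w → a * a * (w * w) ≡ a * w * (a * w)
      regroup a w = solve (a ∷ w ∷ [])

-- Values of a primitive form coprime to a given modulus

-- The ideal (x, y, z) is the whole ring; explicit coefficients replace prime divisors.
Unimodular : ℤ → ℤ → ℤ → Set
Unimodular x y z = ∃ λ s → ∃₂ λ t u → s * x + t * y + u * z ≡ + 1

-- The zero in the middle lets the lemmas on `Unimodular` apply unchanged.
Coprime : ℤ → ℤ → Set
Coprime x z = Unimodular x (+ 0) z

-- Modulo the ideal (x, y), both u and v are units, hence so is u v.
unimodular-* : ∀ {x y u v} → Unimodular x y u → Unimodular x y v → Unimodular x y (u * v)
unimodular-* {x} {y} {u} {v} (s , t , r , e) (s′ , t′ , r′ , e′) =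
  s * (s′ * x + t′ * y + r′ * v) + r * u * s′ ,
  t * (s′ * x + t′ * y + r′ * v) + r * u * t′ , r * r′ ,
  lin₂ (s′ * x + t′ * y + r′ * v) (+ 1) e e′
    (solve (x ∷ y ∷ u ∷ v ∷ s ∷ t ∷ r ∷ s′ ∷ t′ ∷ r′ ∷ []))

unimodular-*ˡ : ∀ {x y} u v → Unimodular x y (u * v) → Unimodular x y u
unimodular-*ˡ {x} {y} u v (s , t , r , e) =
  s , t , r * v , lin₁ (+ 1) e (solve (x ∷ y ∷ u ∷ v ∷ s ∷ t ∷ r ∷ []))

unimodular-*ʳ : ∀ {x y} u v → Unimodular x y (u * v) → Unimodular x y v
unimodular-*ʳ {x} {y} u v (s , t , r , e) =
  s , t , r * u , lin₁ (+ 1) e (solve (x ∷ y ∷ u ∷ v ∷ s ∷ t ∷ r ∷ []))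

coprime-sym : ∀ {x y} → Coprime x y → Coprime y x
coprime-sym {x} {y} (s , t , u , e) =
  u , t , s , lin₁ (+ 1) e (solve (x ∷ y ∷ s ∷ t ∷ u ∷ []))

coprime-shift : ∀ {x v} q → Coprime x v → Coprime (v + x * q) x
coprime-shift {x} {v} q (s , t , u , e) =
  u , t , s - u * q , lin₁ (+ 1) e (solve (x ∷ v ∷ q ∷ s ∷ t ∷ u ∷ []))

-- r divides a power of a; stated through ideals to avoid exponents.
infix 4 _≪_
_≪_ : ℤ → ℤ → Set
r ≪ a = ∀ x y → Unimodular x y a → Unimodular x y r

-- The gcd of a and m is divided out of m until it is a unit; |m| drops each time, and every factor
-- removed divides a.
split-coprime : ∀ a m → m ≢ + 0 → ∃₂ λ s r → m ≡ s * r × Coprime s a × r ≪ a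
split-coprime a m m≢0 = go m m≢0 (<-wellFounded ∣ m ∣)
  where
  1≪a : + 1 ≪ a
  1≪a x y _ = + 0 , + 0 , + 1 , solve (x ∷ y ∷ [])
  rotate : ∀ x y z → x * (y * z) ≡ y * (x * z)
  rotate x y z = solve (x ∷ y ∷ z ∷ [])
  go : ∀ m → m ≢ + 0 → Acc _<_ ∣ m ∣ → ∃₂ λ s r → m ≡ s * r × Coprime s a × r ≪ a
  go m m≢0 (acc rec) with split-gcd a m
  ... | gcdSplit g a′ m′ α β eqa refl bz with ∣ g ∣ ℕ.≟ 1
  ...   | yes ∣g∣≡1 = g * m′ , + 1 , sym (ℤ.*-identityʳ _) ,
          -- Here g = ±1, so multiplying the Bézout identity by g turns its right side into 1.
          (g * β , + 0 , g * α , coprime bz) ,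
          1≪a
    where
    coprime : α * a + β * (g * m′) ≡ g → g * β * (g * m′) + + 0 * + 0 + g * α * a ≡ + 1
    coprime bz = lin₂ g (+ 1) bz (∣i∣≡1⇒i²≡1 g ∣g∣≡1) (solve (g ∷ β ∷ m′ ∷ α ∷ a ∷ []))
  ...   | no ∣g∣≢1 with go m′ m′≢0 (rec m′<m)
    where
    m′≢0 : m′ ≢ + 0
    m′≢0 refl = m≢0 (ℤ.*-zeroʳ g)
    g≢0 : g ≢ + 0
    g≢0 refl = m≢0 refl
    m′<m : ∣ m′ ∣ < ∣ g * m′ ∣
    m′<m = subst (∣ m′ ∣ <_) (trans (ℕ.*-comm ∣ m′ ∣ ∣ g ∣) (sym (ℤ.abs-* g m′)))
      (ℕ.m<m*n ∣ m′ ∣ ∣ g ∣ {{≢-nonZero m′≢0}}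
        (ℕ.≤∧≢⇒< (ℕ.n≢0⇒n>0 (g≢0 ∘ ℤ.∣i∣≡0⇒i≡0)) (∣g∣≢1 ∘ sym)))
  ...     | s , r , refl , cop , r≪a =
    s , g * r , rotate g s r , cop ,
    λ x y uni → unimodular-* (unimodular-*ˡ g a′ (subst (Unimodular x y) eqa uni)) (r≪a x y uni)

-- The order c, a, b puts b in the slot where `unimodular-*` multiplies.
primitive⇒unimodular : ∀ a b c → Primitive (form a b c) → Unimodular c a b
primitive⇒unimodular a b c prim with bezout a b | bezout (ℤ.gcd a b) c
... | s , t , e | s′ , t′ , e′ = t′ , s′ * s , s′ * t , combine (ℤ.gcd a b) e (trans e′ prim)
  where
  combine : ∀ g → s * a + t * b ≡ g → s′ * g + t′ * c ≡ + 1 →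
            t′ * c + s′ * s * a + s′ * t * b ≡ + 1
  combine g e e′ = lin₂ s′ (+ 1) e e′ (solve (a ∷ b ∷ c ∷ s ∷ t ∷ s′ ∷ t′ ∷ g ∷ []))

-- Write m = m₁m₂m₃ with m₁ coprime to a, m₂ coprime to c and m₂m₃ supported on a, m₃ on c;
-- then evaluate at (m₂ , m₁).
coprime-value : ∀ F → Primitive F → ∀ m → m ≢ + 0 → ∃₂ λ p q → Coprime (eval F p q) m
coprime-value (form a b c) prim m m≢0 with split-coprime a m m≢0
... | m₁ , r , refl , m₁⊥a , r≪a with split-coprime c r (λ { refl → m≢0 (ℤ.*-zeroʳ m₁) })
...   | m₂ , m₃ , refl , m₂⊥c , m₃≪c = m₂ , m₁ , unimodular-* n⊥m₁ (unimodular-* n⊥m₂ n⊥m₃)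
  where
  n : ℤ
  n = eval (form a b c) m₂ m₁
  m₁⊥m₂ : Coprime m₁ m₂
  m₁⊥m₂ = unimodular-*ˡ m₂ m₃ (r≪a m₁ (+ 0) m₁⊥a)
  -- The value n is a m₂² modulo m₁ and, further down, c m₁² modulo m₂.
  n⊥m₁ : Coprime n m₁
  n⊥m₁ = subst (λ z → Coprime z m₁) eq
    (coprime-shift (b * m₂ + c * m₁) (unimodular-* m₁⊥a (unimodular-* m₁⊥m₂ m₁⊥m₂)))
    where
    eq : a * (m₂ * m₂) + m₁ * (b * m₂ + c * m₁) ≡ a * m₂ * m₂ + b * m₂ * m₁ + c * m₁ * m₁
    eq = solve (a ∷ b ∷ c ∷ m₁ ∷ m₂ ∷ [])
  n⊥m₂ : Coprime n m₂
  n⊥m₂ = subst (λ z → Coprime z m₂) eq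
    (coprime-shift (b * m₁ + a * m₂)
      (unimodular-* m₂⊥c (unimodular-* (coprime-sym m₁⊥m₂) (coprime-sym m₁⊥m₂))))
    where
    eq : c * (m₁ * m₁) + m₂ * (b * m₁ + a * m₂) ≡ a * m₂ * m₂ + b * m₂ * m₁ + c * m₁ * m₁
    eq = solve (a ∷ b ∷ c ∷ m₁ ∷ m₂ ∷ [])
  -- Modulo (a, c) the value n is b m₁ m₂, a unit there: b by primitivity, m₁ and m₂ since they are
  -- coprime to a and to c respectively.
  bm₁m₂ : Unimodular c a (b * (m₁ * m₂))
  bm₁m₂ = unimodular-* (primitive⇒unimodular a b c prim) (unimodular-* (from-a m₁⊥a) (from-c m₂⊥c))
    where
    from-a : ∀ {x} → Coprime x a → Unimodular c a x
    from-a {x} (s , t , u , e) = + 0 , u , s , lin₁ (+ 1) e (solve (x ∷ a ∷ c ∷ s ∷ t ∷ u ∷ []))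
    from-c : ∀ {x} → Coprime x c → Unimodular c a x
    from-c {x} (s , t , u , e) = u , + 0 , s , lin₁ (+ 1) e (solve (x ∷ a ∷ c ∷ s ∷ t ∷ u ∷ []))
  n-c-a : Unimodular c a (b * (m₁ * m₂)) → Unimodular n c a
  n-c-a (s , t , u , e) = u , s - u * m₁ * m₁ , t - u * m₂ * m₂ , eq
    where
    eq : u * (a * m₂ * m₂ + b * m₂ * m₁ + c * m₁ * m₁) + (s - u * m₁ * m₁) * c
         + (t - u * m₂ * m₂) * a ≡ + 1
    eq = lin₁ (+ 1) e (solve (a ∷ b ∷ c ∷ m₁ ∷ m₂ ∷ s ∷ t ∷ u ∷ []))
  swap : ∀ {x y z} → Unimodular x y z → Unimodular x z y
  swap {x} {y} {z} (s , t , u , e) =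
    s , u , t , lin₁ (+ 1) e (solve (x ∷ y ∷ z ∷ s ∷ t ∷ u ∷ []))
  merge : ∀ {x z} → Unimodular x z z → Coprime x z
  merge {x} {z} (s , t , u , e) =
    s , + 0 , t + u , lin₁ (+ 1) e (solve (x ∷ z ∷ s ∷ t ∷ u ∷ []))
  n⊥m₃ : Coprime n m₃
  -- In the unit ideal (n, c, a), `r≪a` replaces a by m₂ m₃ and hence by m₃; then `m₃≪c` replaces c
  -- by m₃.
  n⊥m₃ = merge (m₃≪c n m₃ (swap (unimodular-*ʳ m₂ m₃ (r≪a n c (n-c-a bm₁m₂)))))

-- Principal forms compared modulo every m

-- A form a x² + b x y + c y² enters as x² + b x y + a c y², which up to a shear is the principal
-- form of its discriminant.
record ⟨_,_⟩≼⟨_,_⟩ (E K e k : ℤ) : Set where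
  field
    represent : ∀ m → m ≢ + 0 → ∀ x y → ∃ λ β → ∃₂ λ δ t →
      x * x + E * x * y + K * y * y ≡ β * β + e * β * δ + k * δ * δ + m * t
open ⟨_,_⟩≼⟨_,_⟩

-- F(U) F(V) = F(U)² (w² + B w y + A C y²) for a V depending linearly on (w , y), while a
-- product of two values of f is a value of x² + b x y + a c y².
image⊆⇒≼ : ∀ f F → Primitive F → (∀ n → Represents F n → Represents f n) →
           ⟨ b F , a F * c F ⟩≼⟨ b f , a f * c f ⟩
represent (image⊆⇒≼ (form a b c) (form A B C) prim F⊆f) m m≢0 w y =
  go (coprime-value (form A B C) prim m m≢0)
  where
  Goal : Set
  Goal = ∃ λ β → ∃₂ λ δ t →
    w * w + B * w * y + A * C * y * y ≡ β * β + b * β * δ + a * c * δ * δ + m * t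
  -- With Ω a root of T² - B T + A C, the vector is s (A p + Ω q)(w + Ω y) in the basis A, Ω.
  composition : ∀ p q s →
    A * (s * (p * w - C * q * y)) * (s * (p * w - C * q * y))
    + B * (s * (p * w - C * q * y)) * (s * (q * w + (A * p + B * q) * y))
    + C * (s * (q * w + (A * p + B * q) * y)) * (s * (q * w + (A * p + B * q) * y))
    ≡ (A * p * p + B * p * q + C * q * q) * (s * s) * (w * w + B * w * y + A * C * y * y)
  composition p q s = solve (A ∷ B ∷ C ∷ p ∷ q ∷ s ∷ w ∷ y ∷ [])
  -- For a ≠ 0 both sides are the norm of (a x + ω z)(a x′ + η z′) / a, with ω, η the roots of T² -
  -- b T + a c.
  product : ∀ x z x′ z′ →
    (a * x * x + b * x * z + c * z * z) * (a * x′ * x′ + b * x′ * z′ + c * z′ * z′)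
    ≡ (a * x * x′ + b * z * x′ + c * z * z′) * (a * x * x′ + b * z * x′ + c * z * z′)
      + b * (a * x * x′ + b * z * x′ + c * z * z′) * (x * z′ - z * x′)
      + a * c * (x * z′ - z * x′) * (x * z′ - z * x′)
  product x z x′ z′ = solve (a ∷ b ∷ c ∷ x ∷ z ∷ x′ ∷ z′ ∷ [])
  -- As s n = 1 - t m, the factor (s n)² is 1 - m (2 - t m) t.
  combine : ∀ n s o t N M P Q → s * n + o * + 0 + t * m ≡ + 1 → P ≡ n → Q ≡ n * (s * s) * N →
            P * Q ≡ M → N ≡ M + m * ((+ 2 - t * m) * t * N)
  combine n s o t N M P Q e e′ e″ e‴ = lin₁ (- (N * (s * n + + 1 - t * m))) e
    (trans (cong (λ z → N - (z + m * ((+ 2 - t * m) * t * N)))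
             (trans (sym e‴) (cong₂ _*_ e′ e″)))
      (solve (n ∷ s ∷ o ∷ t ∷ N ∷ m ∷ [])))
  go : (∃₂ λ p q → Coprime (eval (form A B C) p q) m) → Goal
  go (p , q , s , o , t , e)
    with F⊆f (eval (form A B C) p q) (p , q , refl)
       | F⊆f _ (s * (p * w - C * q * y) , s * (q * w + (A * p + B * q) * y) , refl)
  ... | x , z , eq | x′ , z′ , eq′ =
    a * x * x′ + b * z * x′ + c * z * z′ , x * z′ - z * x′ , _ ,
    combine (eval (form A B C) p q) s o t _ _ _ _ e eq (trans eq′ (composition p q s))
      (product x z x′ z′)

-- The shear x - h y changes the middle coefficient by 2h and keeps the discriminant, which leaves
-- only the middle coefficients 0 and 1 to treat.
≼-shiftˡ : ∀ h {E K e k} → ⟨ + 2 * h + E , K ⟩≼⟨ e , k ⟩ → ⟨ E , K - h * h - E * h ⟩≼⟨ e , k ⟩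
represent (≼-shiftˡ h {E} {K} P≼Q) m m≢0 x y with represent P≼Q m m≢0 (x - h * y) y
... | β , δ , t , eq = β , δ , t , trans (shift x y) eq
  where
  shift : ∀ x y → x * x + E * x * y + (K - h * h - E * h) * y * y
    ≡ (x - h * y) * (x - h * y) + (+ 2 * h + E) * (x - h * y) * y + K * y * y
  shift x y = solve (h ∷ E ∷ K ∷ x ∷ y ∷ [])

≼-shiftʳ : ∀ h {E K e k} → ⟨ E , K ⟩≼⟨ + 2 * h + e , k ⟩ → ⟨ E , K ⟩≼⟨ e , k - h * h - e * h ⟩
represent (≼-shiftʳ h {E} {K} {e} {k} P≼Q) m m≢0 x y with represent P≼Q m m≢0 x y
... | β , δ , t , eq = β + h * δ , δ , t , trans eq (cong (_+ m * t) (shift β δ))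
  where
  shift : ∀ β δ → β * β + (+ 2 * h + e) * β * δ + k * δ * δ
    ≡ (β + h * δ) * (β + h * δ) + e * (β + h * δ) * δ + (k - h * h - e * h) * δ * δ
  shift β δ = solve (h ∷ e ∷ k ∷ β ∷ δ ∷ [])

-- On suitable vectors with even second coordinate, x² + x y + K y² becomes x² + (4K - 1) y², of
-- four times the discriminant.
≼-doubleˡ : ∀ {K e k} → ⟨ + 1 , K ⟩≼⟨ e , k ⟩ → ⟨ + 0 , + 4 * K - + 1 ⟩≼⟨ e , k ⟩
represent (≼-doubleˡ {K} P≼Q) m m≢0 x y with represent P≼Q m m≢0 (x - y) (+ 2 * y)
... | β , δ , t , eq = β , δ , t , trans (double x y) eq
  where
  double : ∀ x y → x * x + + 0 * x * y + (+ 4 * K - + 1) * y * y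
    ≡ (x - y) * (x - y) + + 1 * (x - y) * (+ 2 * y) + K * (+ 2 * y) * (+ 2 * y)
  double x y = solve (K ∷ x ∷ y ∷ [])

-- Squares modulo m

SquareMod : ℤ → ℤ → Set
SquareMod m n = ∃₂ λ r t → n ≡ r * r + m * t

residue-unique : ∀ {h i j} t → i < h → j < h → + i ≡ + j + + h * t → i ≡ j
residue-unique {h} {i} {j} (+ zero) _ _ eq =
  ℤ.+-injective (trans eq (trans (cong (λ z → + j + z) (ℤ.*-zeroʳ (+ h))) (ℤ.+-identityʳ (+ j))))
residue-unique {h} {i} {j} (+ suc n) i<h _ eq = ⊥-elim (ℕ.<⇒≱ i<h
  (subst (h ℕ.≤_) (sym (ℤ.+-injective (trans eq (cong (λ z → + j + z) (sym (ℤ.pos-* h (suc n)))))))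
    (ℕ.≤-trans (ℕ.m≤m*n h (suc n)) (ℕ.m≤n+m (h ℕ.* suc n) j))))
residue-unique {h} {i} {j} -[1+ n ] _ j<h eq = ⊥-elim (ℕ.<⇒≱ j<h
  (subst (h ℕ.≤_) (sym (ℤ.+-injective (trans (move (+ i) (+ j) (+ h) (+ suc n) eq)
      (cong (λ z → + i + z) (sym (ℤ.pos-* h (suc n)))))))
    (ℕ.≤-trans (ℕ.m≤m*n h (suc n)) (ℕ.m≤n+m (h ℕ.* suc n) i))))
  where
  move : ∀ i j h n → i ≡ j + h * - n → j ≡ i + h * n
  move i j h n e = lin₁ (- + 1) e (solve (i ∷ j ∷ h ∷ n ∷ []))

-- A choice of square roots is injective; if it also hit the negative ρ of the root of 1, then
-- ρ ≡ - ρ and 2 ≡ 2 ρ² ≡ 0.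
all-squares⇒∣2 : ∀ h .{{_ : ℕ.NonZero h}} → (∀ n → SquareMod (+ h) n) → ∃ λ q → + 2 ≡ + h * q
all-squares⇒∣2 h sq = conclude (Fin.pigeonhole (ℕ.n<1+n h) roots)
  where
  residue : ℤ → Fin h
  residue x = fromℕ< (ℤ.n%ℕd<d x h)
  root : Fin h → ℤ
  root i = proj₁ (sq (+ toℕ i))
  one : Fin h
  one = residue (+ 1)
  roots : Fin (suc h) → Fin h
  roots Fin.zero    = residue (- root one)
  roots (Fin.suc i) = residue (root i)
  toℕ-residue : ∀ x → ∃ λ t → x ≡ + toℕ (residue x) + + h * t
  toℕ-residue x = x /ℕ h , trans (ℤ.a≡a%ℕn+[a/ℕn]*n x h) (cong₂ _+_
    (cong +_ (sym (Fin.toℕ-fromℕ< (ℤ.n%ℕd<d x h)))) (ℤ.*-comm (x /ℕ h) (+ h)))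
  residue-≡ : ∀ x y → residue x ≡ residue y → ∃ λ t → x ≡ y + + h * t
  residue-≡ x y eq with toℕ-residue x | toℕ-residue y
  ... | t , ex | t′ , ey = t - t′ ,
    combine (+ h) (+ toℕ (residue x)) (+ toℕ (residue y)) (cong (λ i → + toℕ i) eq) t t′ ex ey
    where
    combine : ∀ h i j → i ≡ j → ∀ t t′ → x ≡ i + h * t → y ≡ j + h * t′ → x ≡ y + h * (t - t′)
    combine h i j e t t′ ex ey = lin₃ (+ 1) (+ 1) (- + 1) e ex ey
      (solve (x ∷ y ∷ h ∷ i ∷ j ∷ t ∷ t′ ∷ []))
  root²-injective : ∀ i j → (∃ λ t → root i * root i ≡ root j * root j + + h * t) → i ≡ j
  root²-injective i j (u , e) with sq (+ toℕ i) | sq (+ toℕ j)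
  ... | r , t , eq | r′ , t′ , eq′ = Fin.toℕ-injective (residue-unique (t - t′ + u)
    (Fin.toℕ<n i) (Fin.toℕ<n j) (combine (+ toℕ i) (+ toℕ j) (+ h) r t r′ t′ u eq eq′ e))
    where
    combine : ∀ i j h r t r′ t′ u → i ≡ r * r + h * t → j ≡ r′ * r′ + h * t′ →
              r * r ≡ r′ * r′ + h * u → i ≡ j + h * (t - t′ + u)
    combine i j h r t r′ t′ u e e′ e″ = lin₃ (+ 1) (- + 1) (+ 1) e e′ e″
      (solve (i ∷ j ∷ h ∷ r ∷ t ∷ r′ ∷ t′ ∷ u ∷ []))
  square-cong : ∀ h r r′ t → r ≡ r′ + h * t → ∃ λ u → r * r ≡ r′ * r′ + h * u
  square-cong h r r′ t e = (r + r′) * t , lin₁ (r + r′) e (solve (h ∷ r ∷ r′ ∷ t ∷ []))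
  neg-square-cong : ∀ h r r′ t → - r ≡ r′ + h * t → ∃ λ u → r * r ≡ r′ * r′ + h * u
  neg-square-cong h r r′ t e =
    (r′ - r) * t , lin₁ (r′ - r) e (solve (h ∷ r ∷ r′ ∷ t ∷ []))
  two : ∀ h o ρ t t′ u → o ≡ ρ * ρ + h * t → + 1 ≡ o + h * t′ → - ρ ≡ ρ + h * u →
        + 2 ≡ h * (+ 2 * t + + 2 * t′ - ρ * u)
  two h o ρ t t′ u e e′ e″ = lin₃ (+ 2) (+ 2) (- ρ) e e′ e″
    (solve (h ∷ o ∷ ρ ∷ t ∷ t′ ∷ u ∷ []))
  conclude : (∃₂ λ i j → i Fin.< j × roots i ≡ roots j) → ∃ λ q → + 2 ≡ + h * q
  conclude (Fin.suc i , Fin.suc j , i<j , eq) = ⊥-elim (Fin.<-irrefl (cong Fin.suc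
    (root²-injective i j (let t , e = residue-≡ (root i) (root j) eq
                          in square-cong (+ h) (root i) (root j) t e))) i<j)
  -- Squaring -ρ ≡ `root j` gives 1 ≡ j, so j is `one` and ρ ≡ -ρ follows.
  conclude (Fin.zero , Fin.suc j , _ , eq) with residue-≡ (- root one) (root j) eq
  ... | u , e with root²-injective one j (neg-square-cong (+ h) (root one) (root j) u e)
  ...   | refl = _ , two (+ h) (+ toℕ one) (root one) _ (proj₁ (toℕ-residue (+ 1))) u
                   (proj₂ (proj₂ (sq (+ toℕ one)))) (proj₂ (toℕ-residue (+ 1))) e

-- If K n ≡ r², then K (n + 1) ≡ r² + K · 1² is again a square; reduction of n modulo |m| leaves
-- only natural numbers.
multiples-squares : ∀ m K → m ≢ + 0 → (∀ z y → SquareMod m (z * z + K * (y * y))) →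
                    ∀ n → SquareMod m (K * n)
multiples-squares m K m≢0 sq n = reduce (∣∣-signed m) (naturals (n %ℕ ∣ m ∣))
  where
  instance
    ∣m∣-nonZero : ℕ.NonZero ∣ m ∣
    ∣m∣-nonZero = ≢-nonZero m≢0
  next : ∀ n → SquareMod m (K * n) → SquareMod m (K * (+ 1 + n))
  next n (r , t , e) = combine (sq r (+ 1))
    where
    combine : SquareMod m (r * r + K * (+ 1 * + 1)) → SquareMod m (K * (+ 1 + n))
    combine (r′ , t′ , e′) = r′ , t + t′ ,
      lin₂ (+ 1) (+ 1) e e′ (solve (K ∷ n ∷ r ∷ t ∷ r′ ∷ t′ ∷ m ∷ []))
  naturals : ∀ n → SquareMod m (K * + n)
  naturals zero    = + 0 , + 0 , solve (K ∷ m ∷ [])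
  naturals (suc n) = next (+ n) (naturals n)
  reduce : (∃ λ σ → + ∣ m ∣ ≡ σ * m) → SquareMod m (K * + (n %ℕ ∣ m ∣)) → SquareMod m (K * n)
  reduce (σ , eσ) (r , t , e) = r , _ ,
    combine (+ (n %ℕ ∣ m ∣)) (n /ℕ ∣ m ∣) (+ ∣ m ∣) (ℤ.a≡a%ℕn+[a/ℕn]*n n ∣ m ∣) eσ e
    where
    combine : ∀ i q M → n ≡ i + q * M → M ≡ σ * m → K * i ≡ r * r + m * t →
              K * n ≡ r * r + m * (t + K * q * σ)
    combine i q M e e′ e″ = lin₃ K (K * q) (+ 1) e e′ e″
      (solve (n ∷ i ∷ q ∷ M ∷ σ ∷ m ∷ K ∷ r ∷ t ∷ []))

-- With g = gcd(m, K) and m = g h, every g n is a square mod m; multiplying its root by that of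
-- g and dividing by g shows that every n is a square mod h.
squares⇒∣2K : ∀ m K → m ≢ + 0 → (∀ z y → SquareMod m (z * z + K * (y * y))) →
              ∃ λ q → + 2 * K ≡ m * q
squares⇒∣2K m K m≢0 sq = go (split-gcd m K) m≢0 (multiples-squares m K m≢0 sq)
  where
  go : ∀ {m K} → GCDSplit m K → m ≢ + 0 → (∀ n → SquareMod m (K * n)) → ∃ λ q → + 2 * K ≡ m * q
  go (gcdSplit g h κ s t refl refl bz) m≢0 sq′ =
    finish (∣∣-signed h) (all-squares⇒∣2 ∣ h ∣ {{≢-nonZero h≢0}} mod-∣h∣)
    where
    g≢0 : g ≢ + 0
    g≢0 refl = m≢0 refl
    h≢0 : h ≢ + 0
    h≢0 refl = m≢0 (ℤ.*-zeroʳ g)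
    -- Since t K = g - s m, the multiple K (t n) is g n modulo m.
    multiple-of-g : ∀ n → ∃₂ λ x u → x * x ≡ g * (n - h * u)
    multiple-of-g n = convert (sq′ (t * n))
      where
      convert : SquareMod (g * h) (g * κ * (t * n)) → ∃₂ λ x u → x * x ≡ g * (n - h * u)
      convert (x , u , e) = x , u + s * n ,
        lin₂ (- + 1) n e bz (solve (g ∷ h ∷ κ ∷ s ∷ t ∷ n ∷ x ∷ u ∷ []))
    mod-h : ∀ n → SquareMod h n
    mod-h n = combine (multiple-of-g n) (multiple-of-g (+ 1))
      where
      combine : (∃₂ λ x u → x * x ≡ g * (n - h * u)) → (∃₂ λ x u → x * x ≡ g * (+ 1 - h * u)) →
                SquareMod h n
      combine (x , u , e) (x′ , u′ , e′) = extract (square-cofactor g≢0 squared)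
        where
        squared : x * x′ * (x * x′) ≡ g * g * ((n - h * u) * (+ 1 - h * u′))
        squared = lin₂ (x′ * x′) (g * (n - h * u)) e e′
          (solve (x ∷ x′ ∷ g ∷ n ∷ h ∷ u ∷ u′ ∷ []))
        extract : (∃ λ w → x * x′ ≡ g * w × w * w ≡ (n - h * u) * (+ 1 - h * u′)) → SquareMod h n
        extract (w , _ , e″) = w , n * u′ + u - h * u * u′ ,
          lin₁ (- + 1) e″ (solve (w ∷ n ∷ h ∷ u ∷ u′ ∷ []))
    mod-∣h∣ : ∀ n → SquareMod (+ ∣ h ∣) n
    mod-∣h∣ n = convert (mod-h n) (+ ∣ h ∣) (signed-∣∣ h)
      where
      convert : SquareMod h n → ∀ H → (∃ λ σ → h ≡ σ * H) → SquareMod H n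
      convert (r , t , e) H (σ , eσ) =
        r , σ * t , lin₂ (+ 1) t e eσ (solve (n ∷ r ∷ t ∷ h ∷ H ∷ σ ∷ []))
    finish : (∃ λ σ → + ∣ h ∣ ≡ σ * h) → (∃ λ q → + 2 ≡ + ∣ h ∣ * q) →
             ∃ λ q → + 2 * (g * κ) ≡ g * h * q
    finish (σ , eσ) (q , e) = σ * q * κ , combine (+ ∣ h ∣) eσ e
      where
      combine : ∀ H → H ≡ σ * h → + 2 ≡ H * q → + 2 * (g * κ) ≡ g * h * (σ * q * κ)
      combine H e e′ = lin₂ (q * g * κ) (g * κ) e e′ (solve (g ∷ κ ∷ h ∷ σ ∷ q ∷ H ∷ []))

-- Divisibility between the constant coefficients

-- Modulo k the form x² + k y² takes only squares, so k divides 2K; residues modulo 8k exclude an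
-- odd quotient.
≼⇒∣-even-even : ∀ {K k} → k ≢ + 0 → ⟨ + 0 , K ⟩≼⟨ + 0 , k ⟩ → ∃ λ q → K ≡ k * q
≼⇒∣-even-even {K} {k} k≢0 P≼Q = by-parity (squares⇒∣2K k K k≢0 squares)
  where
  squares : ∀ z y → SquareMod k (z * z + K * (y * y))
  squares z y = convert (represent P≼Q k k≢0 z y)
    where
    convert : (∃ λ β → ∃₂ λ δ t → z * z + + 0 * z * y + K * y * y
                ≡ β * β + + 0 * β * δ + k * δ * δ + k * t) → SquareMod k (z * z + K * (y * y))
    convert (β , δ , t , e) =
      β , δ * δ + t , lin₁ (+ 1) e (solve (z ∷ y ∷ K ∷ k ∷ β ∷ δ ∷ t ∷ []))
  8k≢0 : + 8 * k ≢ + 0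
  8k≢0 = *-≢0 {+ 8} (λ ()) k≢0
  -- If 2K = k q with q odd, then β² ≡ K (mod k) exhibits k = 2g, K = g q and β² = g v with
  -- v odd; a root of the value at (β , 2) then contradicts no-solution-mod-8.
  not-odd : ∀ h → + 2 * K ≡ k * (+ 2 * h + + 1) → ⊥
  not-odd h 2K≡kq = go (represent P≼Q (+ 8 * k) 8k≢0 (+ 0) (+ 1))
    where
    go : (∃ λ β → ∃₂ λ δ t → + 0 * + 0 + + 0 * + 0 * + 1 + K * + 1 * + 1
           ≡ β * β + + 0 * β * δ + k * δ * δ + + 8 * k * t) → ⊥
    go (β , δ , t , e) = go′ p g k≡2g β²≡gv (represent P≼Q (+ 8 * k) 8k≢0 β (+ 2))
      where
      -- Inserting K = β² + k δ² + 8 k t into 2K = k (2h + 1) gives k = 2 (β² - k p); hence g = k /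
      -- 2 and β² = g + k p = g (2p + 1).
      p g : ℤ
      p = h - δ * δ - + 8 * t
      g = β * β - k * (h - δ * δ - + 8 * t)
      k≡2g : k ≡ + 2 * (β * β - k * (h - δ * δ - + 8 * t))
      k≡2g = lin₂ (+ 2) (- + 1) e 2K≡kq (solve (h ∷ β ∷ δ ∷ t ∷ K ∷ k ∷ []))
      β²≡gv : β * β ≡ (β * β - k * (h - δ * δ - + 8 * t)) * (+ 2 * (h - δ * δ - + 8 * t) + + 1)
      β²≡gv = cancel-2 (lin₃ (- + 2) (+ 1) (+ 2 * (h - δ * δ - + 8 * t) + + 1) e 2K≡kq k≡2g
        (solve (h ∷ β ∷ δ ∷ t ∷ K ∷ k ∷ [])))
      go′ : ∀ p g → k ≡ + 2 * g → β * β ≡ g * (+ 2 * p + + 1) →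
            (∃ λ β′ → ∃₂ λ δ′ t′ → β * β + + 0 * β * + 2 + K * + 2 * + 2
              ≡ β′ * β′ + + 0 * β′ * δ′ + k * δ′ * δ′ + + 8 * k * t′) → ⊥
      go′ p g k≡2g β²≡gv (β′ , δ′ , t′ , e′) = extract (square-cofactor g≢0 squared)
        where
        g≢0 : g ≢ + 0
        g≢0 refl = k≢0 k≡2g
        K≡gq : K ≡ g * (+ 2 * h + + 1)
        K≡gq = cancel-2 (lin₂ (+ 1) (+ 2 * h + + 1) 2K≡kq k≡2g (solve (h ∷ g ∷ K ∷ k ∷ [])))
        -- From β² + 4K = β′² + k δ′² + 8 k t′, where k, K and β² are all multiples of g.
        β′²≡ge : β′ * β′ ≡ g * (+ 2 * p + + 1 + + 4 * (+ 2 * h + + 1) - + 2 * δ′ * δ′ - + 16 * t′)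
        β′²≡ge = lin₂ (- + 1) (- (δ′ * δ′ + + 8 * t′)) e′ k≡2g
          (lin₂ (+ 1) (+ 4) β²≡gv K≡gq
            (solve (h ∷ g ∷ K ∷ k ∷ p ∷ β ∷ β′ ∷ δ′ ∷ t′ ∷ [])))
        squared : β′ * β * (β′ * β) ≡ g * g *
          ((+ 2 * p + + 1 + + 4 * (+ 2 * h + + 1) - + 2 * δ′ * δ′ - + 16 * t′) * (+ 2 * p + + 1))
        squared = lin₂ (β * β)
          (g * (+ 2 * p + + 1 + + 4 * (+ 2 * h + + 1) - + 2 * δ′ * δ′ - + 16 * t′)) β′²≡ge β²≡gv
          (solve (h ∷ g ∷ p ∷ β ∷ β′ ∷ δ′ ∷ t′ ∷ []))
        extract : (∃ λ r → β′ * β ≡ g * r × r * r ≡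
          (+ 2 * p + + 1 + + 4 * (+ 2 * h + + 1) - + 2 * δ′ * δ′ - + 16 * t′) * (+ 2 * p + + 1)) → ⊥
        extract (r , _ , e″) = no-solution-mod-8 r δ′ t′ p h e″
  by-parity : (∃ λ q → + 2 * K ≡ k * q) → ∃ λ q → K ≡ k * q
  by-parity (q , e) = case parity q returning (λ _ → ∃ λ q → K ≡ k * q) of λ where
    (h , inj₁ refl) → h , cancel-2 (lin₁ (+ 1) e (solve (h ∷ K ∷ k ∷ [])))
    (h , inj₂ refl) → ⊥-elim (not-odd h e)

-- As 4 (x² + x y + k y²) = (2x + y)² - d y² with d = 1 - 4k, the values are squares modulo d. So d
-- divides 2K, and d is odd.
≼⇒∣-even-odd : ∀ {K k} → ⟨ + 0 , K ⟩≼⟨ + 1 , k ⟩ → ∃ λ q → K ≡ (+ 1 - + 4 * k) * q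
≼⇒∣-even-odd {K} {k} P≼Q = halve (squares⇒∣2K (+ 1 - + 4 * k) K d≢0 squares)
  where
  d≢0 : + 1 - + 4 * k ≢ + 0
  d≢0 e = 1-not-even (+ 2 * k) (lin₁ (+ 1) e (solve (k ∷ [])))
  -- 1 - 2k is the inverse of 2 modulo the discriminant.
  squares : ∀ z y → SquareMod (+ 1 - + 4 * k) (z * z + K * (y * y))
  squares z y = convert (represent P≼Q (+ 1 - + 4 * k) d≢0 ((+ 1 - + 2 * k) * z) ((+ 1 - + 2 * k) * y))
    where
    convert : (∃ λ β → ∃₂ λ δ t →
        (+ 1 - + 2 * k) * z * ((+ 1 - + 2 * k) * z)
        + + 0 * ((+ 1 - + 2 * k) * z) * ((+ 1 - + 2 * k) * y)
        + K * ((+ 1 - + 2 * k) * y) * ((+ 1 - + 2 * k) * y)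
        ≡ β * β + + 1 * β * δ + k * δ * δ + (+ 1 - + 4 * k) * t) →
      SquareMod (+ 1 - + 4 * k) (z * z + K * (y * y))
    convert (β , δ , t , e) = + 2 * β + δ ,
      + 4 * t - δ * δ - (+ 3 - + 4 * k) * (z * z + K * (y * y)) ,
      lin₁ (+ 4) e (solve (z ∷ y ∷ K ∷ k ∷ β ∷ δ ∷ t ∷ []))
  halve : (∃ λ q → + 2 * K ≡ (+ 1 - + 4 * k) * q) → ∃ λ q → K ≡ (+ 1 - + 4 * k) * q
  halve (q , e) = (+ 1 - + 2 * k) * q - K , lin₁ (+ 1 - + 2 * k) e (solve (K ∷ k ∷ q ∷ []))

-- x² - d y² omits the residue 2 mod 4, which x² + x y + k y² takes when k is even.
≼⇒odd : ∀ {k} → ⟨ + 1 , k ⟩≼⟨ + 0 , + 4 * k - + 1 ⟩ → ∃ λ h → k ≡ + 2 * h + + 1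
≼⇒odd {k} P≼Q = case parity k returning (λ _ → Odd) of λ where
    (h , inj₂ e) → h , e
    (h , inj₁ e) → ⊥-elim (case parity h of λ where
      -- For k ≡ 0 modulo 4 the value at (1, 1) is 2 modulo 4; for k ≡ 2 it is the value at (0, 1).
      (i , inj₁ e′) → go₁₁ i (represent P≼Q (+ 4) (λ ()) (+ 1) (+ 1)) e e′
      (i , inj₂ e′) → go₀₁ i (represent P≼Q (+ 4) (λ ()) (+ 0) (+ 1)) e e′)
  where
  Odd : Set
  Odd = ∃ λ h → k ≡ + 2 * h + + 1
  go₁₁ : ∀ {h} i → (∃ λ β → ∃₂ λ δ t → + 1 * + 1 + + 1 * + 1 * + 1 + k * + 1 * + 1
      ≡ β * β + + 0 * β * δ + (+ 4 * k - + 1) * δ * δ + + 4 * t) →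
    k ≡ + 2 * h + + 0 → h ≡ + 2 * i + + 0 → ⊥
  go₁₁ {h} i (β , δ , t , e) e′ e″ = i²-j²≢2mod4 β δ (i - k * δ * δ - t)
    (lin₃ (- + 1) (+ 1) (+ 2) e e′ e″ (solve (h ∷ i ∷ k ∷ β ∷ δ ∷ t ∷ [])))
  go₀₁ : ∀ {h} i → (∃ λ β → ∃₂ λ δ t → + 0 * + 0 + + 1 * + 0 * + 1 + k * + 1 * + 1
      ≡ β * β + + 0 * β * δ + (+ 4 * k - + 1) * δ * δ + + 4 * t) →
    k ≡ + 2 * h + + 0 → h ≡ + 2 * i + + 1 → ⊥
  go₀₁ {h} i (β , δ , t , e) e′ e″ = i²-j²≢2mod4 β δ (i - k * δ * δ - t)
    (lin₃ (- + 1) (+ 1) (+ 2) e e′ e″ (solve (h ∷ i ∷ k ∷ β ∷ δ ∷ t ∷ [])))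

-- Signs

square-pos : ∀ x → x ≢ + 0 → ∃ λ n → x * x ≡ + suc n
square-pos (+ zero)  x≢0 = ⊥-elim (x≢0 refl)
square-pos (+ suc n) _   = _ , refl
square-pos -[1+ n ]  _   = _ , refl

square-nonNeg : ∀ x → ∃ λ n → x * x ≡ + n
square-nonNeg (+ zero)  = 0 , refl
square-nonNeg (+ suc n) = _ , refl
square-nonNeg -[1+ n ]  = _ , refl

no-zero-sum : ∀ β δ A m n → A ≢ + 0 →
              β * β + + suc n * (δ * δ) + + 4 * + suc m * (A * A) ≢ + 0
no-zero-sum β δ A m n A≢0 eq with square-nonNeg β | square-nonNeg δ | square-pos A A≢0
... | x , ex | y , ey | z , ez = impossible
  (trans (cong₂ _+_ (cong₂ _+_ (sym ex) (trans (ℤ.pos-* (suc n) y) (cong (+ suc n *_) (sym ey))))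
                    (trans (ℤ.pos-* (4 ℕ.* suc m) (suc z)) (cong (λ w → + (4 ℕ.* suc m) * w) (sym ez))))
         eq)
  where
  impossible : + (x ℕ.+ suc n ℕ.* y) + + (4 ℕ.* suc m ℕ.* suc z) ≢ + 0
  impossible e with ℕ.m+n≡0⇒n≡0 (x ℕ.+ suc n ℕ.* y) {4 ℕ.* suc m ℕ.* suc z} (ℤ.+-injective e)
  ... | ()

-- F takes the values A and - A D, whereas products of two values of f are nonnegative.
no-opposite-signs : ∀ f F → (∀ n → Represents F n → Represents f n) → ¬ IsSquare (disc F) →
                    disc f ℤ.< + 0 → + 0 ℤ.< disc F → ⊥
no-opposite-signs (form a b c) (form A B C) F⊆f nsq d<0 0<D =
  negative (disc (form a b c)) (disc (form A B C)) d<0 0<D refl refl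
  where
  -- A form with A = 0 has the square discriminant B².
  A≢0 : A ≢ + 0
  A≢0 refl = nsq (B , disc-A≡0 B C)
    where
    disc-A≡0 : ∀ B C → B * B ≡ B * B - + 4 * + 0 * C
    disc-A≡0 B C = solve (B ∷ C ∷ [])
  first : ∀ A B C → A * + 1 * + 1 + B * + 1 * + 0 + C * + 0 * + 0 ≡ A
  first A B C = solve (A ∷ B ∷ C ∷ [])
  second : ∀ A B C → A * (- B) * (- B) + B * (- B) * (+ 2 * A) + C * (+ 2 * A) * (+ 2 * A)
    ≡ - (A * (B * B - + 4 * A * C))
  second A B C = solve (A ∷ B ∷ C ∷ [])
  -- 4 f(u) f(v) is the square of the polar form minus `disc f` times the squared determinant of u,
  -- v. Here f(u) f(v) = -A² D, and d stands for the negative of `disc f`.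
  combine : ∀ d D x z x′ z′ → b * b - + 4 * a * c ≡ - d → B * B - + 4 * A * C ≡ D →
    a * x * x + b * x * z + c * z * z ≡ A →
    a * x′ * x′ + b * x′ * z′ + c * z′ * z′ ≡ - (A * (B * B - + 4 * A * C)) →
    (+ 2 * a * x * x′ + b * (x * z′ + z * x′) + + 2 * c * z * z′)
    * (+ 2 * a * x * x′ + b * (x * z′ + z * x′) + + 2 * c * z * z′)
    + d * ((x * z′ - z * x′) * (x * z′ - z * x′)) + + 4 * D * (A * A) ≡ + 0
  combine d D x z x′ z′ ed eD e e′ =
    lin₂ ((x * z′ - z * x′) * (x * z′ - z * x′)) (- (+ 4 * A * A)) ed eD
      (lin₂ (+ 4 * (a * x′ * x′ + b * x′ * z′ + c * z′ * z′)) (+ 4 * A) e e′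
        (solve (a ∷ b ∷ c ∷ A ∷ B ∷ C ∷ d ∷ D ∷ x ∷ z ∷ x′ ∷ z′ ∷ [])))
  negative : ∀ d D → d ℤ.< + 0 → + 0 ℤ.< D → b * b - + 4 * a * c ≡ d → B * B - + 4 * A * C ≡ D → ⊥
  negative -[1+ n ] (+ suc m) _ _ ed eD
    with F⊆f A (+ 1 , + 0 , first A B C)
       | F⊆f (- (A * (B * B - + 4 * A * C))) (- B , + 2 * A , second A B C)
  ... | x , z , e | x′ , z′ , e′ =
    no-zero-sum (+ 2 * a * x * x′ + b * (x * z′ + z * x′) + + 2 * c * z * z′) (x * z′ - z * x′)
      A m n A≢0 (combine (+ suc n) (+ suc m) x z x′ z′ ed eD e e′)
  negative (+ _) _ (+<+ ()) _ _ _
  negative -[1+ _ ] (+ zero) _ (+<+ ()) _ _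

sameSign : ∀ d D → d ≢ + 0 → D ≢ + 0 → ¬ (d ℤ.< + 0 × + 0 ℤ.< D) → ¬ (+ 0 ℤ.< d × D ℤ.< + 0) →
           SameSign d D
sameSign (+ zero)  _         d≢0 _   _ _ = ⊥-elim (d≢0 refl)
sameSign _         (+ zero)  _   D≢0 _ _ = ⊥-elim (D≢0 refl)
sameSign (+ suc _) (+ suc _) _ _ _ _ = inj₁ (+<+ ℕ.z<s , +<+ ℕ.z<s)
sameSign -[1+ _ ]  -[1+ _ ]  _ _ _ _ = inj₂ (-<+ , -<+)
sameSign -[1+ _ ]  (+ suc _) _ _ ¬-+ _ = ⊥-elim (¬-+ (-<+ , +<+ ℕ.z<s))
sameSign (+ suc _) -[1+ _ ]  _ _ _ ¬+- = ⊥-elim (¬+- (+<+ ℕ.z<s , -<+))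

sameSign-4* : ∀ {d D} → SameSign d D → SameSign (+ 4 * d) D
sameSign-4* {+ suc _}  (inj₁ (_ , 0<D)) = inj₁ (+<+ ℕ.z<s , 0<D)
sameSign-4* { -[1+ _ ]} (inj₂ (_ , D<0)) = inj₂ (-<+ , D<0)
sameSign-4* {+ _}      (inj₂ (+<+ () , _))
sameSign-4* {+ zero}   (inj₁ (+<+ () , _))

sameSign-sym : ∀ {d D} → SameSign d D → SameSign D d
sameSign-sym (inj₁ (p , q)) = inj₁ (q , p)
sameSign-sym (inj₂ (p , q)) = inj₂ (q , p)

sameSign-∣∣ : ∀ d D → SameSign d D → ∣ d ∣ ≡ ∣ D ∣ → d ≡ D
sameSign-∣∣ (+ _)    (+ _)    _ refl = refl
sameSign-∣∣ -[1+ _ ] -[1+ _ ] _ refl = refl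
sameSign-∣∣ (+ _)    -[1+ _ ] (inj₁ (_ , ())) _
sameSign-∣∣ (+ _)    -[1+ _ ] (inj₂ (+<+ () , _)) _
sameSign-∣∣ -[1+ _ ] (+ _)    (inj₁ (() , _)) _
sameSign-∣∣ -[1+ _ ] (+ _)    (inj₂ (_ , +<+ ())) _

∣-antisym : ∀ {d D} → SameSign d D → (∃ λ q → D ≡ d * q) → (∃ λ q → d ≡ D * q) → d ≡ D
∣-antisym {d} {D} same (q , e) (q′ , e′) = sameSign-∣∣ d D same (ℕ.∣-antisym
  (ℕ.divides ∣ q ∣ (trans (cong ∣_∣ e) (trans (ℤ.abs-* d q) (ℕ.*-comm ∣ d ∣ ∣ q ∣))))
  (ℕ.divides ∣ q′ ∣ (trans (cong ∣_∣ e′) (trans (ℤ.abs-* D q′) (ℕ.*-comm ∣ D ∣ ∣ q′ ∣)))))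

-- Parity of the middle coefficient

-- Meant for e = 0 and e = 1, where e² = e makes e - 4k the discriminant of x² + e x y + k y².
record NormalForm (f : BQF) (e k : ℤ) : Set where
  constructor normalForm
  field
    disc≡ : disc f ≡ e - + 4 * k
    ≼ˡ : ∀ {E K} → ⟨ b f , a f * c f ⟩≼⟨ E , K ⟩ → ⟨ e , k ⟩≼⟨ E , K ⟩
    ≼ʳ : ∀ {E K} → ⟨ E , K ⟩≼⟨ b f , a f * c f ⟩ → ⟨ E , K ⟩≼⟨ e , k ⟩
open NormalForm

normalise : ∀ f → ∃ λ k → NormalForm f (+ 0) k ⊎ NormalForm f (+ 1) k
normalise (form a b c) = go (parity b)
  where
  go : ∀ {b} → (∃ λ h → b ≡ + 2 * h + + 0 ⊎ b ≡ + 2 * h + + 1) →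
       ∃ λ k → NormalForm (form a b c) (+ 0) k ⊎ NormalForm (form a b c) (+ 1) k
  go (h , inj₁ refl) = a * c - h * h - + 0 * h , inj₁ (normalForm disc-even (≼-shiftˡ h) (≼-shiftʳ h))
    where
    disc-even : (+ 2 * h + + 0) * (+ 2 * h + + 0) - + 4 * a * c
      ≡ + 0 - + 4 * (a * c - h * h - + 0 * h)
    disc-even = solve (a ∷ c ∷ h ∷ [])
  go (h , inj₂ refl) = a * c - h * h - + 1 * h , inj₂ (normalForm disc-odd (≼-shiftˡ h) (≼-shiftʳ h))
    where
    disc-odd : (+ 2 * h + + 1) * (+ 2 * h + + 1) - + 4 * a * c
      ≡ + 1 - + 4 * (a * c - h * h - + 1 * h)
    disc-odd = solve (a ∷ c ∷ h ∷ [])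

-- Discriminants compared by parity

module _ {f F : BQF} {k K : ℤ} (same : SameSign (disc f) (disc F)) where

  even-even : k ≢ + 0 → K ≢ + 0 → NormalForm f (+ 0) k → NormalForm F (+ 0) K →
    ⟨ + 0 , k ⟩≼⟨ + 0 , K ⟩ → ⟨ + 0 , K ⟩≼⟨ + 0 , k ⟩ → disc f ≡ disc F
  even-even k≢0 K≢0 nf nF f≼F F≼f = ∣-antisym same
    (scale k K (disc≡ nf) (disc≡ nF) (≼⇒∣-even-even k≢0 F≼f))
    (scale K k (disc≡ nF) (disc≡ nf) (≼⇒∣-even-even K≢0 f≼F))
    where
    scale : ∀ {d D} k K → d ≡ + 0 - + 4 * k → D ≡ + 0 - + 4 * K → (∃ λ q → K ≡ k * q) →
            ∃ λ q → D ≡ d * q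
    scale {d} {D} k K e e′ (q , e″) =
      q , lin₃ (- q) (+ 1) (- + 4) e e′ e″ (solve (d ∷ D ∷ k ∷ K ∷ q ∷ []))

  -- Doubling makes the left middle coefficient 0, and the new constant 4K - 1 is -D.
  odd-odd : NormalForm f (+ 1) k → NormalForm F (+ 1) K →
    ⟨ + 1 , k ⟩≼⟨ + 1 , K ⟩ → ⟨ + 1 , K ⟩≼⟨ + 1 , k ⟩ → disc f ≡ disc F
  odd-odd nf nF f≼F F≼f = ∣-antisym same
    (scale k K (disc≡ nf) (disc≡ nF) (≼⇒∣-even-odd (≼-doubleˡ F≼f)))
    (scale K k (disc≡ nF) (disc≡ nf) (≼⇒∣-even-odd (≼-doubleˡ f≼F)))
    where
    scale : ∀ {d D} k K → d ≡ + 1 - + 4 * k → D ≡ + 1 - + 4 * K →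
            (∃ λ q → + 4 * K - + 1 ≡ (+ 1 - + 4 * k) * q) → ∃ λ q → D ≡ d * q
    scale {d} {D} k K e e′ (q , e″) =
      - q , lin₃ q (+ 1) (- + 1) e e′ e″ (solve (d ∷ D ∷ k ∷ K ∷ q ∷ []))

  -- From F to f, d divides K, so 4d divides D = -4K. From f to F, doubling shows that K divides 4k
  -- - 1 = -d, so D divides 4d.
  odd-even : K ≢ + 0 → NormalForm f (+ 1) k → NormalForm F (+ 0) K →
    ⟨ + 1 , k ⟩≼⟨ + 0 , K ⟩ → ⟨ + 0 , K ⟩≼⟨ + 1 , k ⟩ → + 4 * disc f ≡ disc F
  odd-even K≢0 nf nF f≼F F≼f = ∣-antisym (sameSign-4* same)
    (scale (disc≡ nf) (disc≡ nF) (≼⇒∣-even-odd F≼f))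
    (scale′ (disc≡ nf) (disc≡ nF) (≼⇒∣-even-even K≢0 (≼-doubleˡ f≼F)))
    where
    scale : ∀ {d D} → d ≡ + 1 - + 4 * k → D ≡ + 0 - + 4 * K →
            (∃ λ q → K ≡ (+ 1 - + 4 * k) * q) → ∃ λ q → D ≡ + 4 * d * q
    scale {d} {D} e e′ (q , e″) =
      - q , lin₃ (+ 4 * q) (+ 1) (- + 4) e e′ e″ (solve (d ∷ D ∷ k ∷ K ∷ q ∷ []))
    scale′ : ∀ {d D} → d ≡ + 1 - + 4 * k → D ≡ + 0 - + 4 * K →
             (∃ λ q → + 4 * k - + 1 ≡ K * q) → ∃ λ q → + 4 * d ≡ D * q
    scale′ {d} {D} e e′ (q , e″) =
      q , lin₃ (+ 4) (- q) (- + 4) e e′ e″ (solve (d ∷ D ∷ k ∷ K ∷ q ∷ []))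

  -- 4d = D means K = 4k - 1, so `≼⇒odd` makes k odd, and then 1 - 4k ≡ 5 modulo 8.
  odd-even⇒5mod8 : NormalForm f (+ 1) k → NormalForm F (+ 0) K →
    ⟨ + 1 , k ⟩≼⟨ + 0 , K ⟩ → + 4 * disc f ≡ disc F → + 8 ∣ (disc f - + 5)
  odd-even⇒5mod8 nf nF f≼F 4d≡D = ∣⇒∣ᵤ {+ 8} {disc f - + 5} (residue (disc≡ nf)
    (≼⇒odd (subst (λ z → ⟨ + 1 , k ⟩≼⟨ + 0 , z ⟩) (K≡ (disc≡ nf) (disc≡ nF) 4d≡D) f≼F)))
    where
    K≡ : ∀ {d D} → d ≡ + 1 - + 4 * k → D ≡ + 0 - + 4 * K → + 4 * d ≡ D → K ≡ + 4 * k - + 1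
    K≡ {d} {D} e e′ e″ = cancel {+ 4} (λ ())
      (lin₃ (- + 4) (+ 1) (+ 1) e e′ e″ (solve (d ∷ D ∷ k ∷ K ∷ [])))
    residue : ∀ {d} → d ≡ + 1 - + 4 * k → (∃ λ h → k ≡ + 2 * h + + 1) → + 8 Signed.∣ (d - + 5)
    residue {d} e (h , e′) =
      divides (- (h + + 1)) (lin₂ (+ 1) (- + 4) e e′ (solve (d ∷ k ∷ h ∷ [])))

nonsquare⇒k≢0 : ∀ {f k} → ¬ IsSquare (disc f) → NormalForm f (+ 0) k → k ≢ + 0
nonsquare⇒k≢0 nsq nf refl = nsq (+ 0 , sym (disc≡ nf))

theorem3p10 : (f F : BQF) → Primitive f → Primitive F →
    ¬ IsSquare (disc f) → ¬ IsSquare (disc F) → SameImage f F →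
    SameSign (disc f) (disc F)
    × ((disc f ≡ disc F) ⊎ (disc f ≡ + 4 * disc F) ⊎ (+ 4 * disc f ≡ disc F))
    × (0 < ∣ disc f ∣ → ∣ disc f ∣ < ∣ disc F ∣ → + 8 ∣ (disc f - + 5))
theorem3p10 f F prim-f prim-F nsq-f nsq-F image = same , by-parities (normalise f) (normalise F)
  where
  f⊆F : ∀ n → Represents f n → Represents F n
  f⊆F n = Equivalence.to (image n)
  F⊆f : ∀ n → Represents F n → Represents f n
  F⊆f n = Equivalence.from (image n)
  f≼F : ⟨ b f , a f * c f ⟩≼⟨ b F , a F * c F ⟩
  f≼F = image⊆⇒≼ F f prim-f f⊆F
  F≼f : ⟨ b F , a F * c F ⟩≼⟨ b f , a f * c f ⟩
  F≼f = image⊆⇒≼ f F prim-F F⊆f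
  same : SameSign (disc f) (disc F)
  same = sameSign (disc f) (disc F) (λ e → nsq-f (+ 0 , sym e)) (λ e → nsq-F (+ 0 , sym e))
    (λ { (d<0 , 0<D) → no-opposite-signs f F F⊆f nsq-F d<0 0<D })
    (λ { (0<d , D<0) → no-opposite-signs F f f⊆F nsq-f D<0 0<d })
  Goal : Set
  Goal = ((disc f ≡ disc F) ⊎ (disc f ≡ + 4 * disc F) ⊎ (+ 4 * disc f ≡ disc F))
    × (0 < ∣ disc f ∣ → ∣ disc f ∣ < ∣ disc F ∣ → + 8 ∣ (disc f - + 5))
  from-≡ : disc f ≡ disc F → Goal
  from-≡ d≡D = inj₁ d≡D , λ _ d<D → ⊥-elim (ℕ.<-irrefl (cong ∣_∣ d≡D) d<D)
  by-parities : (∃ λ k → NormalForm f (+ 0) k ⊎ NormalForm f (+ 1) k) →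
                (∃ λ K → NormalForm F (+ 0) K ⊎ NormalForm F (+ 1) K) → Goal
  by-parities (k , inj₁ nf) (K , inj₁ nF) = from-≡
    (even-even same (nonsquare⇒k≢0 nsq-f nf) (nonsquare⇒k≢0 nsq-F nF) nf nF
      (≼ˡ nf (≼ʳ nF f≼F)) (≼ˡ nF (≼ʳ nf F≼f)))
  by-parities (k , inj₂ nf) (K , inj₂ nF) = from-≡
    (odd-odd same nf nF (≼ˡ nf (≼ʳ nF f≼F)) (≼ˡ nF (≼ʳ nf F≼f)))
  -- Here |d| = 4|D|, which excludes |d| < |D|.
  by-parities (k , inj₁ nf) (K , inj₂ nF) = inj₂ (inj₁ (sym 4D≡d)) , λ _ d<D →
    ⊥-elim (ℕ.<⇒≱ d<D (subst (∣ disc F ∣ ℕ.≤_)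
      (trans (sym (ℤ.abs-* (+ 4) (disc F))) (cong ∣_∣ 4D≡d)) (ℕ.m≤n*m ∣ disc F ∣ 4)))
    where
    4D≡d : + 4 * disc F ≡ disc f
    4D≡d = odd-even (sameSign-sym same) (nonsquare⇒k≢0 nsq-f nf) nF nf
      (≼ˡ nF (≼ʳ nf F≼f)) (≼ˡ nf (≼ʳ nF f≼F))
  by-parities (k , inj₂ nf) (K , inj₁ nF) =
    inj₂ (inj₂ 4d≡D) , λ _ _ → odd-even⇒5mod8 same nf nF (≼ˡ nf (≼ʳ nF f≼F)) 4d≡D
    where
    4d≡D : + 4 * disc f ≡ disc F
    4d≡D = odd-even same (nonsquare⇒k≢0 nsq-F nF) nf nF
      (≼ˡ nf (≼ʳ nF f≼F)) (≼ˡ nF (≼ʳ nf F≼f))
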